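{- If $G$ is a finite, simple, connected, uniquely dimensional graph of order $n$ and diameter $d$, then $\beta(G)\leq n-d-2$.
   Context: For vertices $u,v$ of a connected graph $G$, $d(u,v)$ is the distance between them; the diameter is $\max_{u,v} d(u,v)$. For an ordered set $W=\{w_1,\dots,w_k\}\subseteq V(G)$ and $v\in V(G)$, $r(v|W)=(d(v,w_1),\dots,d(v,w_k))$. $W$ is a resolving set if distinct vertices have distinct representations $r(\cdot|W)$. A resolving set of minimum cardinality is a metric basis; its cardinality is the metric dimension $\beta(G)$. $G$ is uniquely dimensional if it has exactly one metric basis.
   Formalization: The graph is assumed to have order at least 2; the one-vertex graph is uniquely dimensional with metric dimension 0 and diameter 0 and violates the stated bound (0 ≤ −1), so it is excluded. -}

module Defs where

open import Data.Nat using (ℕ; zero; suc; _+_; _≤_)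
open import Data.Fin using (Fin)
open import Data.Fin.Subset using (Subset; _∈_; ∣_∣)
open import Data.Product using (Σ; ∃; ∃-syntax; _×_)
open import Relation.Binary.PropositionalEquality using (_≡_)
open import Relation.Nullary using (¬_)

record Graph (n : ℕ) : Set₁ where
  field
    Adj     : Fin n → Fin n → Set
    symAdj  : ∀ {u v} → Adj u v → Adj v u
    irrefl  : ∀ {u} → ¬ Adj u u
open Graph public

data Walk {n : ℕ} (G : Graph n) : Fin n → Fin n → ℕ → Set where
  nil  : ∀ {u} → Walk G u u zero
  cons : ∀ {u w v k} → Adj G u w → Walk G w v k → Walk G u v (suc k)

Connected : ∀ {n} → Graph n → Set
Connected G = ∀ u v → ∃[ k ] Walk G u v k

IsDistance : ∀ {n} → Graph n → (Fin n → Fin n → ℕ) → Set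
IsDistance G d = ∀ u v → Walk G u v (d u v) × (∀ k → Walk G u v k → d u v ≤ k)

IsDiameter : ∀ {n} → (Fin n → Fin n → ℕ) → ℕ → Set
IsDiameter d D = (∀ u v → d u v ≤ D) × (∃[ u ] ∃[ v ] d u v ≡ D)

Resolving : ∀ {n} → (Fin n → Fin n → ℕ) → Subset n → Set
Resolving d W = ∀ u v → (∀ w → w ∈ W → d u w ≡ d v w) → u ≡ v

MetricBasis : ∀ {n} → (Fin n → Fin n → ℕ) → Subset n → Set
MetricBasis d W = Resolving d W × (∀ W′ → Resolving d W′ → ∣ W ∣ ≤ ∣ W′ ∣)

UniquelyDimensional : ∀ {n} → (Fin n → Fin n → ℕ) → Set
UniquelyDimensional d =
  (∃[ W ] MetricBasis d W) × (∀ W W′ → MetricBasis d W → MetricBasis d W′ → W ≡ W′)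

{-# OPTIONS --safe #-}
module Submission where

-- Let u 0, …, u D be a diametral path, and suppose the unique basis W has n − D − 1 elements.
-- For a vertex z off the path let i = d(u 0, z) and e = D − d(u D, z), so e ≤ i. The complement of
-- {z, u 1, …, u D} resolves G, and hence equals W, unless z and u i have the same distance to every
-- other vertex off the path; likewise for {u 0, …, u (D − 1)} and u e. Up to reversing the path the
-- first exception does not occur, and then neither does the second. This forces z to be adjacent
-- to u (i − 1) and u (e + 1), which fixes its distances to the rest of the path. If i = e, then z and
-- u i are twins; any two z with e < i are twins of each other. Exchanging twins maps a basis to a
-- basis, so W contains both members of every twin pair. Since only D + 1 vertices lie outside W, this
-- leaves W either disjoint from the path, and then not separating u e from u i for any z in W, or
-- made of a single u α and twins of it, and then not separating two vertices at equal distance from u α.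

open import Defs
open import Data.Nat using (ℕ; zero; suc; _+_; _∸_; _≤_; _<_; z≤n; s≤s; _≟_; _<?_)
open import Data.Nat.Properties
open import Data.Fin using (Fin) renaming (_≟_ to _≟ꟳ_)
open import Data.Fin.Properties using (any?)
open import Data.Fin.Subset using (Subset; ∣_∣; ⊤; _∪_; ⁅_⁆; _-_; _∈_; _∉_; inside; outside)
open import Data.Fin.Subset.Properties using (_∈?_; ∈⊤; ∣⊤∣≡n; ∣p∣≤n; x∈⁅x⁆; x∈⁅y⁆⇒x≡y; x∈p∪q⁻; x∈p∪q⁺;
  p─q⊆p; x∈p∧x≢y⇒x∈p-y; x∈p⇒∣p-x∣<∣p∣; drop-there; p⊆q⇒∣p∣≤∣q∣)
open import Data.List using (List; []; _∷_; length; foldr; applyUpTo)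
open import Data.List.Properties using (length-applyUpTo)
open import Data.List.Membership.Propositional using () renaming (_∈_ to _∈ₗ_; _∉_ to _∉ₗ_)
open import Data.List.Membership.Propositional.Properties using (∈-applyUpTo⁺; ∈-applyUpTo⁻)
open import Data.List.Membership.DecPropositional using () renaming (_∈?_ to member?)
open import Data.List.Relation.Unary.All using (_∷_)
open import Data.List.Relation.Unary.All.Properties using (All¬⇒¬Any; ¬Any⇒All¬)
open import Data.List.Relation.Unary.AllPairs using ([]; _∷_)
open import Data.List.Relation.Unary.Any using (here; there)
open import Data.List.Relation.Unary.Unique.Propositional using (Unique)
open import Data.List.Relation.Unary.Unique.Propositional.Properties using (applyUpTo⁺₁)
open import Data.Product using (∃-syntax; _×_; _,_; proj₁; proj₂)
open import Data.Sum using (_⊎_; inj₁; inj₂)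
open import Data.Empty using (⊥; ⊥-elim)
open import Data.Vec using ([]; _∷_; here; there; tail)
open import Function using (_∘_)
open import Relation.Binary.PropositionalEquality using (_≡_; _≢_; refl; sym; trans; cong; cong₂; subst;
  module ≡-Reasoning)
open import Relation.Binary.Definitions using (tri<; tri≈; tri>)
open import Relation.Nullary using (¬_; Dec; yes; no; contradiction)
open import Relation.Nullary.Decidable using (¬?; _×-dec_; decidable-stable)

private
  variable
    n : ℕ

-- Cardinalities of finite subsets and complements of lists

x∉p-x : ∀ (p : Subset n) x → x ∉ p - x
x∉p-x (_ ∷ p) Fin.zero ()
x∉p-x (_ ∷ p) (Fin.suc x) (there x∈) = x∉p-x p x x∈

∣p∣≤1+∣p-x∣ : ∀ (p : Subset n) x → ∣ p ∣ ≤ suc ∣ p - x ∣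
∣p∣≤1+∣p-x∣ (s ∷ p) Fin.zero = ≤-trans (∣s∷p∣≤1+∣p∣ s)
  (s≤s (p⊆q⇒∣p∣≤∣q∣ {p = p} {q = tail ((s ∷ p) - Fin.zero)} (drop-there ∘ incl)))
  where
  incl : ∀ {y} → y ∈ p → Fin.suc y ∈ (s ∷ p) - Fin.zero
  incl y∈p = x∈p∧x≢y⇒x∈p-y {p = s ∷ p} {y = Fin.zero} (there y∈p) (λ ())
  ∣s∷p∣≤1+∣p∣ : ∀ s → ∣ s ∷ p ∣ ≤ suc ∣ p ∣
  ∣s∷p∣≤1+∣p∣ inside  = ≤-refl
  ∣s∷p∣≤1+∣p∣ outside = n≤1+n _
∣p∣≤1+∣p-x∣ (inside ∷ p) (Fin.suc x) = s≤s (∣p∣≤1+∣p-x∣ p x)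
∣p∣≤1+∣p-x∣ (outside ∷ p) (Fin.suc x) = ∣p∣≤1+∣p-x∣ p x

∣p∪⁅x⁆∣≤1+∣p∣ : ∀ (p : Subset n) x → ∣ p ∪ ⁅ x ⁆ ∣ ≤ suc ∣ p ∣
∣p∪⁅x⁆∣≤1+∣p∣ p x = ≤-trans (∣p∣≤1+∣p-x∣ (p ∪ ⁅ x ⁆) x) (s≤s (p⊆q⇒∣p∣≤∣q∣ incl))
  where
  incl : ∀ {y} → y ∈ (p ∪ ⁅ x ⁆) - x → y ∈ p
  incl y∈ with x∈p∪q⁻ p ⁅ x ⁆ (p─q⊆p _ ⁅ x ⁆ y∈)
  ... | inj₁ y∈p = y∈p
  ... | inj₂ y∈x with refl ← x∈⁅y⁆⇒x≡y x y∈x = contradiction y∈ (x∉p-x (p ∪ ⁅ x ⁆) x)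

without : List (Fin n) → Subset n
without = foldr (λ x p → p - x) ⊤

∈-without : ∀ {x : Fin n} xs → x ∉ₗ xs → x ∈ without xs
∈-without []       _  = ∈⊤
∈-without (y ∷ xs) x∉ = x∈p∧x≢y⇒x∈p-y (∈-without xs (x∉ ∘ there)) (x∉ ∘ here)

∉-without : ∀ {x : Fin n} xs → x ∈ₗ xs → x ∉ without xs
∉-without (y ∷ xs) (here refl) x∈ = x∉p-x (without xs) y x∈
∉-without (y ∷ xs) (there x∈xs) x∈ = ∉-without xs x∈xs (p─q⊆p _ ⁅ y ⁆ x∈)

∣without∣ : ∀ {xs : List (Fin n)} → Unique xs → ∣ without xs ∣ + length xs ≤ n
∣without∣ [] = ≤-trans (≤-reflexive (+-identityʳ _)) (∣p∣≤n ⊤)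
∣without∣ {xs = x ∷ xs} (x∉ ∷ uniq) = ≤-trans (≤-reflexive (+-suc _ (length xs)))
  (≤-trans (+-monoˡ-≤ (length xs) (x∈p⇒∣p-x∣<∣p∣ (∈-without xs (All¬⇒¬Any x∉)))) (∣without∣ uniq))

-- The listed elements are moved into `p` one at a time, each raising the cardinality by at most
-- one, until nothing is missing; repetitions in the list do no harm.
covered : ∀ (p : Subset n) xs → (∀ x → x ∉ p → x ∈ₗ xs) → n ≤ ∣ p ∣ + length xs
covered {n} p [] cov = ≤-trans (≤-reflexive (sym (∣⊤∣≡n n)))
  (≤-trans (p⊆q⇒∣p∣≤∣q∣ {p = ⊤} {q = p} all∈) (m≤m+n ∣ p ∣ 0))
  where
  all∈ : ∀ {x} → x ∈ ⊤ → x ∈ p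
  all∈ {x} _ with x ∈? p
  ... | yes x∈p = x∈p
  ... | no x∉p with () ← cov x x∉p
covered p (y ∷ xs) cov = ≤-trans (covered (p ∪ ⁅ y ⁆) xs cov′)
  (≤-trans (+-monoˡ-≤ (length xs) (∣p∪⁅x⁆∣≤1+∣p∣ p y)) (≤-reflexive (sym (+-suc _ _))))
  where
  cov′ : ∀ x → x ∉ p ∪ ⁅ y ⁆ → x ∈ₗ xs
  cov′ x x∉ with cov x (x∉ ∘ x∈p∪q⁺ ∘ inj₁)
  ... | here refl = contradiction (x∈p∪q⁺ (inj₂ (x∈⁅x⁆ x))) x∉
  ... | there x∈xs = x∈xs

-- Graph distance and geodesics

record IsPathMetric (d : Fin n → Fin n → ℕ) : Set where
  field
    reflexive : ∀ x → d x x ≡ 0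
    separate  : ∀ {x y} → d x y ≡ 0 → x ≡ y
    symmetric : ∀ x y → d x y ≡ d y x
    triangle  : ∀ x y z → d x z ≤ d x y + d y z
    step      : ∀ {x y k} → d x y ≡ suc k → ∃[ z ] d x z ≡ 1 × d z y ≡ k

module _ {G : Graph n} where

  _++ʷ_ : ∀ {x y z k l} → Walk G x y k → Walk G y z l → Walk G x z (k + l)
  nil      ++ʷ w = w
  cons a v ++ʷ w = cons a (v ++ʷ w)

  reverseʷ : ∀ {x y k} → Walk G x y k → Walk G y x k
  reverseʷ nil = nil
  reverseʷ {k = suc k} (cons a w) = subst (Walk G _ _) (+-comm k 1) (reverseʷ w ++ʷ cons (symAdj G a) nil)

  distance⇒metric : ∀ {d} → IsDistance G d → IsPathMetric d
  distance⇒metric {d} isd = record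
    { reflexive = λ x → n≤0⇒n≡0 (proj₂ (isd x x) 0 nil)
    ; separate  = λ {x} {y} dxy≡0 → sep (subst (Walk G x y) dxy≡0 (proj₁ (isd x y)))
    ; symmetric = λ x y → ≤-antisym (sym≤ x y) (sym≤ y x)
    ; triangle  = tri
    ; step      = λ {x} {y} e → st e (subst (Walk G x y) e (proj₁ (isd x y)))
    }
    where
    sep : ∀ {x y} → Walk G x y 0 → x ≡ y
    sep nil = refl
    sym≤ : ∀ x y → d x y ≤ d y x
    sym≤ x y = proj₂ (isd x y) _ (reverseʷ (proj₁ (isd y x)))
    tri : ∀ x y z → d x z ≤ d x y + d y z
    tri x y z = proj₂ (isd x z) _ (proj₁ (isd x y) ++ʷ proj₁ (isd y z))
    st : ∀ {x y k} → d x y ≡ suc k → Walk G x y (suc k) → ∃[ z ] d x z ≡ 1 × d z y ≡ k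
    st {x} {y} {k} e (cons {w = z} a w) = z , ≤-antisym dxz≤1 1≤dxz , ≤-antisym dzy≤k k≤dzy
      where
      dxz≤1 = proj₂ (isd x z) 1 (cons a nil)
      dzy≤k = proj₂ (isd z y) k w
      1+k≤ : suc k ≤ d x z + d z y
      1+k≤ = subst (_≤ d x z + d z y) e (tri x z y)
      1≤dxz : 1 ≤ d x z
      1≤dxz = +-cancelʳ-≤ k 1 (d x z) (≤-trans 1+k≤ (+-monoʳ-≤ (d x z) dzy≤k))
      k≤dzy : k ≤ d z y
      k≤dzy = ≤-pred (≤-trans 1+k≤ (+-monoˡ-≤ (d z y) dxz≤1))

-- Positions past `D` are unconstrained, so `u` can be total on `ℕ`; the additive form of `gap`
-- avoids truncated subtraction.
record Geodesic (d : Fin n → Fin n → ℕ) (D : ℕ) : Set where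
  field
    u   : ℕ → Fin n
    gap : ∀ {a b} → a ≤ b → b ≤ D → d (u a) (u b) + a ≡ b

module PathMetric {d : Fin n → Fin n → ℕ} (M : IsPathMetric d) where
  open IsPathMetric M public

  geodesic : ∀ {D x y} → d x y ≡ D → Geodesic d D
  geodesic {D} {x} {y} dxy≡D = record { u = at D x ; gap = gap }
    where
    -- The distance to `y` is a hypothesis of the last component only, so `at` can iterate `next`
    -- without carrying proofs; `y` itself is kept fixed.
    next : ∀ k x → ∃[ z ] d x z ≤ 1 × (d x y ≡ suc k → d z y ≡ k)
    next k x with d x y in eq
    ... | zero = x , ≤-trans (≤-reflexive (reflexive x)) z≤n , λ ()
    ... | suc l with z , dxz , dzy ← step eq = z , ≤-reflexive dxz , λ { refl → dzy }

    at : ℕ → Fin n → ℕ → Fin n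
    at _       x zero    = x
    at zero    x (suc m) = x
    at (suc k) x (suc m) = at k (proj₁ (next k x)) m

    at-step : ∀ k x m → d (at k x m) (at k x (suc m)) ≤ 1
    at-step zero x zero = ≤-trans (≤-reflexive (reflexive x)) z≤n
    at-step zero x (suc m) = ≤-trans (≤-reflexive (reflexive x)) z≤n
    at-step (suc k) x zero = proj₁ (proj₂ (next k x))
    at-step (suc k) x (suc m) = at-step k _ m

    at-end : ∀ k x → d x y ≡ k → at k x k ≡ y
    at-end zero x e = separate e
    at-end (suc k) x e = at-end k _ (proj₂ (proj₂ (next k x)) e)

    short : ∀ a c → d (at D x a) (at D x (c + a)) ≤ c
    short a zero = ≤-reflexive (reflexive _)
    short a (suc c) = ≤-trans (triangle _ (at D x (c + a)) _)
      (≤-trans (+-mono-≤ (short a c) (at-step D x (c + a))) (≤-reflexive (+-comm c 1)))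

    short′ : ∀ {a b} → a ≤ b → d (at D x a) (at D x b) ≤ b ∸ a
    short′ {a} {b} a≤b = subst (λ c → d (at D x a) (at D x c) ≤ b ∸ a) (m∸n+n≡m a≤b) (short a (b ∸ a))

    gap : ∀ {a b} → a ≤ b → b ≤ D → d (at D x a) (at D x b) + a ≡ b
    gap {a} {b} a≤b b≤D = ≤-antisym
      (≤-trans (+-monoˡ-≤ a (short′ a≤b)) (≤-reflexive (m∸n+n≡m a≤b)))
      -- A shortcut between positions `a` and `b` would give a route from `x` to `y` shorter than
      -- `D`.
      (+-cancelʳ-≤ (D ∸ b) b _ (begin
        b + (D ∸ b)                              ≡⟨ m+[n∸m]≡n b≤D ⟩
        D                                        ≡⟨ dxy≡D ⟨
        d x y                                    ≡⟨ cong (d x) (at-end D x dxy≡D) ⟨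
        d x (p D)                                ≤⟨ triangle x (p b) (p D) ⟩
        d x (p b) + d (p b) (p D)                ≤⟨ +-mono-≤ (triangle x (p a) (p b)) (short′ b≤D) ⟩
        d x (p a) + d (p a) (p b) + (D ∸ b)      ≤⟨ +-monoˡ-≤ (D ∸ b) (+-monoˡ-≤ (d (p a) (p b)) (short′ {0} z≤n)) ⟩
        a + d (p a) (p b) + (D ∸ b)              ≡⟨ cong (_+ (D ∸ b)) (+-comm a _) ⟩
        d (p a) (p b) + a + (D ∸ b)              ∎))
      where
      open ≤-Reasoning
      p = at D x

  -- Resolving sets and twins

  resolving-without : ∀ xs → (∀ {x y} → x ∈ₗ xs → y ∈ₗ xs → (∀ w → w ∉ₗ xs → d x w ≡ d y w) → x ≡ y) →
    Resolving d (without xs)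
  resolving-without xs sep x y same with member? _≟ꟳ_ x xs | member? _≟ꟳ_ y xs
  -- A vertex that is not omitted is separated from every other by its distance zero to itself, so
  -- only pairs of omitted vertices matter.
  ... | no x∉ | _ = sym (separate (trans (sym (same x (∈-without xs x∉))) (reflexive x)))
  ... | yes _ | no y∉ = separate (trans (same y (∈-without xs y∉)) (reflexive y))
  ... | yes x∈ | yes y∈ = sep x∈ y∈ λ w w∉ → same w (∈-without xs w∉)

  -- Covers adjacent and nonadjacent twins alike, since `d p q` is left free.
  Twins : Fin n → Fin n → Set
  Twins p q = ∀ w → w ≢ p → w ≢ q → d p w ≡ d q w

  twins-sym : ∀ {p q} → Twins p q → Twins q p
  twins-sym tw w w≢q w≢p = sym (tw w w≢p w≢q)

  -- Exchanging twins is an isometry, so it maps a basis to a basis.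
  resolving-swap : ∀ {W p q} → Twins p q → p ∉ W → q ∈ W → Resolving d W → Resolving d ((W - q) ∪ ⁅ p ⁆)
  resolving-swap {W} {p} {q} tw p∉W q∈W res x y same = go (x ≟ꟳ p) (y ≟ꟳ p) (x ≟ꟳ q) (y ≟ꟳ q)
    where
    W′ = (W - q) ∪ ⁅ p ⁆

    p∈W′ : p ∈ W′
    p∈W′ = x∈p∪q⁺ (inj₂ (x∈⁅x⁆ p))

    keep : ∀ {w} → w ∈ W → w ≢ q → w ∈ W′
    keep w∈W w≢q = x∈p∪q⁺ (inj₁ (x∈p∧x≢y⇒x∈p-y w∈W w≢q))

    transfer : ∀ {y} → y ≢ p → y ≢ q → d y p ≡ d y q
    transfer {y} y≢p y≢q = trans (symmetric y p) (trans (tw y y≢p y≢q) (symmetric q y))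

    -- Here `p` stands in for `q`: if `q` and `y` agreed on `W′`, then `p` and `y` would agree on
    -- `W`.
    not-q : ∀ y → y ≢ p → y ≢ q → ¬ (∀ w → w ∈ W′ → d q w ≡ d y w)
    not-q y y≢p y≢q same′ = y≢p (sym (res p y agree))
      where
      agree : ∀ w → w ∈ W → d p w ≡ d y w
      agree w w∈W with w ≟ꟳ q
      ... | yes refl = trans (symmetric p q) (trans (same′ p p∈W′) (transfer y≢p y≢q))
      ... | no w≢q = trans (tw w (λ { refl → p∉W w∈W }) w≢q) (same′ w (keep w∈W w≢q))

    go : Dec (x ≡ p) → Dec (y ≡ p) → Dec (x ≡ q) → Dec (y ≡ q) → x ≡ y
    go (yes refl) _ _ _ = sym (separate (trans (sym (same p p∈W′)) (reflexive p)))
    go (no _) (yes refl) _ _ = separate (trans (same p p∈W′) (reflexive p))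
    go (no _) (no _) (yes refl) (yes refl) = refl
    go (no _) (no y≢p) (yes refl) (no y≢q) = contradiction same (not-q y y≢p y≢q)
    go (no x≢p) (no _) (no x≢q) (yes refl) = contradiction (λ w w∈ → sym (same w w∈)) (not-q x x≢p x≢q)
    go (no x≢p) (no y≢p) (no x≢q) (no y≢q) = res x y agree
      where
      agree : ∀ w → w ∈ W → d x w ≡ d y w
      agree w w∈W with w ≟ꟳ q
      ... | yes refl = trans (sym (transfer x≢p x≢q)) (trans (same p p∈W′) (transfer y≢p y≢q))
      ... | no w≢q = same w (keep w∈W w≢q)

  reverse : ∀ {D} → Geodesic d D → Geodesic d D
  reverse {D} γ = record { u = λ a → u (D ∸ a) ; gap = gap′ }
    where
    open Geodesic γ
    gap′ : ∀ {a b} → a ≤ b → b ≤ D → d (u (D ∸ a)) (u (D ∸ b)) + a ≡ b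
    gap′ {a} {b} a≤b b≤D = +-cancelʳ-≡ (D ∸ b) _ _ (begin
      d (u (D ∸ a)) (u (D ∸ b)) + a + (D ∸ b)  ≡⟨ cong (λ k → k + a + (D ∸ b)) (symmetric _ _) ⟩
      δ + a + (D ∸ b)                          ≡⟨ +-assoc δ a _ ⟩
      δ + (a + (D ∸ b))                        ≡⟨ cong (δ +_) (+-comm a _) ⟩
      δ + ((D ∸ b) + a)                        ≡⟨ +-assoc δ _ a ⟨
      δ + (D ∸ b) + a                          ≡⟨ cong (_+ a) (gap (∸-monoʳ-≤ D a≤b) (m∸n≤m D a)) ⟩
      (D ∸ a) + a                              ≡⟨ m∸n+n≡m (≤-trans a≤b b≤D) ⟩
      D                                        ≡⟨ m+[n∸m]≡n b≤D ⟨
      b + (D ∸ b)                              ∎)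
      where
      open ≡-Reasoning
      δ = d (u (D ∸ b)) (u (D ∸ a))

  -- Vertices off a diametral path, measured from `u 0`

  module Path {D} (bounded : ∀ x y → d x y ≤ D) (γ : Geodesic d D) where
    open Geodesic γ public

    level : Fin n → ℕ
    level x = d (u 0) x

    foot : Fin n → Fin n
    foot x = u (level x)

    level-u : ∀ {a} → a ≤ D → level (u a) ≡ a
    level-u a≤D = trans (sym (+-identityʳ _)) (gap z≤n a≤D)

    u-injective : ∀ {a b} → a ≤ D → b ≤ D → u a ≡ u b → a ≡ b
    u-injective a≤D b≤D e = trans (sym (level-u a≤D)) (trans (cong level e) (level-u b≤D))

    Off : Fin n → Set
    Off z = ∀ {a} → a ≤ D → z ≢ u a

    -- The path vertex at position `a` has level `a`, so comparing `z` with its own foot decides the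
    -- matter.
    on⊎off : ∀ z → (∃[ a ] a ≤ D × z ≡ u a) ⊎ Off z
    on⊎off z with z ≟ꟳ foot z
    ... | yes e = inj₁ (level z , bounded (u 0) z , e)
    ... | no ≢foot = inj₂ λ { {a} a≤D refl → ≢foot (cong u (sym (level-u a≤D))) }

    off? : ∀ z → Dec (Off z)
    off? z with on⊎off z
    ... | inj₁ (_ , a≤D , e) = no λ off → off a≤D e
    ... | inj₂ off = yes off

    Aligned : Fin n → Set
    Aligned z = ∀ w → Off w → w ≢ z → d z w ≡ d (foot z) w

    AllAligned : Set
    AllAligned = ∀ z → Off z → Aligned z

    beyond : List (Fin n)
    beyond = applyUpTo (u ∘ suc) D

    u0∉beyond : u 0 ∉ₗ beyond
    u0∉beyond u0∈ with ∈-applyUpTo⁻ (u ∘ suc) u0∈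
    ... | a , a<D , e = 0≢1+n (u-injective z≤n a<D e)

    off⇒∉beyond : ∀ {z} → Off z → z ∉ₗ beyond
    off⇒∉beyond off z∈ with ∈-applyUpTo⁻ (u ∘ suc) z∈
    ... | a , a<D , e = off a<D e

    unique-beyond : Unique beyond
    unique-beyond = applyUpTo⁺₁ (u ∘ suc) D λ i<j j<D e →
      <⇒≢ i<j (suc-injective (u-injective (<-trans i<j j<D) j<D e))

    level-sep : ∀ {xs x y} → u 0 ∉ₗ xs → (∀ w → w ∉ₗ xs → d x w ≡ d y w) → level x ≡ level y
    level-sep u0∉ same = trans (symmetric _ _) (trans (same (u 0) u0∉) (symmetric _ _))

    beyond-sep : ∀ {x y} → x ∈ₗ beyond → y ∈ₗ beyond → level x ≡ level y → x ≡ y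
    beyond-sep x∈ y∈ e with ∈-applyUpTo⁻ (u ∘ suc) x∈ | ∈-applyUpTo⁻ (u ∘ suc) y∈
    ... | a , a<D , refl | b , b<D , refl = cong u (trans (sym (level-u a<D)) (trans e (level-u b<D)))

    beyond-foot : ∀ {x z} → x ∈ₗ beyond → level z ≡ level x → foot z ≡ x
    beyond-foot x∈ e with ∈-applyUpTo⁻ (u ∘ suc) x∈
    ... | a , a<D , refl = cong u (trans e (level-u a<D))

    -- The vertex `u 0` is kept, and the omitted vertices have pairwise different distances from it.
    resolving-beyond : Resolving d (without beyond)
    resolving-beyond = resolving-without beyond λ x∈ y∈ same →
      beyond-sep x∈ y∈ (level-sep u0∉beyond same)

    ∣without-beyond∣ : ∣ without beyond ∣ + D ≤ n
    ∣without-beyond∣ = subst (λ k → ∣ without beyond ∣ + k ≤ n) (length-applyUpTo (u ∘ suc) D) (∣without∣ unique-beyond)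

    ∣without-z∷beyond∣ : ∀ {z} → Off z → ∣ without (z ∷ beyond) ∣ + suc D ≤ n
    ∣without-z∷beyond∣ {z} off = subst (λ k → ∣ without (z ∷ beyond) ∣ + suc k ≤ n) (length-applyUpTo (u ∘ suc) D)
      (∣without∣ (¬Any⇒All¬ beyond (off⇒∉beyond off) ∷ unique-beyond))

    u0∉z∷beyond : ∀ {z} → Off z → u 0 ∉ₗ z ∷ beyond
    u0∉z∷beyond off (here e)   = off z≤n (sym e)
    u0∉z∷beyond off (there u0∈) = u0∉beyond u0∈

    -- A level of u 0 meets z ∷ beyond in at most one element, except that foot z and z share one.
    aligned⊎resolving : ∀ z → Off z → Aligned z ⊎ Resolving d (without (z ∷ beyond))
    aligned⊎resolving z off with any? (λ w → off? w ×-dec ¬? (w ≟ꟳ z) ×-dec ¬? (d z w ≟ d (foot z) w))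
    ... | no none = inj₁ λ w off-w w≢z → decidable-stable (d z w ≟ d (foot z) w) λ ≢ → none (w , off-w , w≢z , ≢)
    ... | yes (w , off-w , w≢z , ≢) = inj₂ (resolving-without (z ∷ beyond) sep)
      where
      w∉ : w ∉ₗ z ∷ beyond
      w∉ (here e)   = w≢z e
      w∉ (there w∈) = off⇒∉beyond off-w w∈

      foot-split : ∀ {x} → x ∈ₗ beyond → ¬ (∀ v → v ∉ₗ z ∷ beyond → d z v ≡ d x v)
      foot-split x∈ same with refl ← beyond-foot x∈ (level-sep (u0∉z∷beyond off) same) = ≢ (same w w∉)

      sep : ∀ {x y} → x ∈ₗ z ∷ beyond → y ∈ₗ z ∷ beyond → (∀ v → v ∉ₗ z ∷ beyond → d x v ≡ d y v) → x ≡ y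
      sep (here refl) (here refl) same = refl
      sep (here refl) (there y∈)  same = contradiction same (foot-split y∈)
      sep (there x∈)  (here refl) same = contradiction (λ v v∉ → sym (same v v∉)) (foot-split x∈)
      sep (there x∈)  (there y∈)  same = beyond-sep x∈ y∈ (level-sep (u0∉z∷beyond off) same)

    -- The last vertex before z on a geodesic from u 0 can be taken on the path.
    near : ∀ z → Off z → (∀ v → Off v → d z v ≡ 1 → suc (level v) ≡ level z → Aligned v) →
      ∀ {a} → a < level z → d z (u a) + a ≡ level z
    near z off al {a} a<i with level z in eq
    ... | suc k with v , dzv , dv0 ← step (trans (symmetric z (u 0)) eq) = ≤-antisym upper lower
      where
      lv : level v ≡ k
      lv = trans (symmetric (u 0) v) dv0

      k≤D : k ≤ D
      k≤D = subst (_≤ D) lv (bounded (u 0) v)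

      a≤k : a ≤ k
      a≤k = ≤-pred a<i

      dzk : d z (u k) ≡ 1
      dzk with on⊎off v
      ... | inj₁ (b , b≤D , refl) = subst (λ c → d z (u c) ≡ 1) (trans (sym (level-u b≤D)) lv) dzv
      -- An aligned `v` off the path can be replaced by its foot `u k`, which is as far from `z` as
      -- `v` is, namely at distance one.
      ... | inj₂ off-v = subst (λ c → d z (u c) ≡ 1) lv (trans (symmetric z _)
        (trans (sym (al v off-v dzv (cong suc lv) z off z≢v)) (trans (symmetric v z) dzv)))
        where
        z≢v : z ≢ v
        z≢v refl = 0≢1+n (trans (sym (reflexive z)) dzv)

      upper : d z (u a) + a ≤ suc k
      upper = begin
        d z (u a) + a                   ≤⟨ +-monoˡ-≤ a (triangle z (u k) (u a)) ⟩
        d z (u k) + d (u k) (u a) + a   ≡⟨ cong₂ (λ p q → p + q + a) dzk (symmetric (u k) (u a)) ⟩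
        suc (d (u a) (u k) + a)         ≡⟨ cong suc (gap a≤k k≤D) ⟩
        suc k                           ∎
        where open ≤-Reasoning

      lower : suc k ≤ d z (u a) + a
      lower = begin
        suc k                           ≡⟨ eq ⟨
        d (u 0) z                       ≤⟨ triangle (u 0) (u a) z ⟩
        d (u 0) (u a) + d (u a) z       ≡⟨ cong₂ _+_ (level-u (≤-trans a≤k k≤D)) (symmetric (u a) z) ⟩
        a + d z (u a)                   ≡⟨ +-comm a _ ⟩
        d z (u a) + a                   ∎
        where open ≤-Reasoning

  -- Combining the measurements from both ends

  module TwoSided {D} (bounded : ∀ x y → d x y ≤ D) (γ : Geodesic d D) where
    open Path bounded γ public
    module R = Path bounded (reverse γ)

    -- The position, counted from `u 0`, of the foot of `z` with respect to the reversed path.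
    colevel : Fin n → ℕ
    colevel z = D ∸ R.level z

    colevel≤level : ∀ z → colevel z ≤ level z
    colevel≤level z = m≤n+o⇒m∸n≤o D (R.level z) (begin
      D                        ≡⟨ level-u ≤-refl ⟨
      d (u 0) (u D)            ≤⟨ triangle (u 0) z (u D) ⟩
      level z + d z (u D)      ≡⟨ cong (level z +_) (symmetric z (u D)) ⟩
      level z + R.level z      ≡⟨ +-comm (level z) _ ⟩
      R.level z + level z      ∎)
      where open ≤-Reasoning

    off-reverse : ∀ {z} → Off z → R.Off z
    off-reverse off {a} _ = off (m∸n≤m D a)

    off-unreverse : ∀ {z} → R.Off z → Off z
    off-unreverse off {a} a≤D z≡ua = off (m∸n≤m D a) (trans z≡ua (cong u (sym (m∸[m∸n]≡n a≤D))))

    colevel<D : ∀ {z} → Off z → colevel z < D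
    colevel<D {z} off with R.level z in eq
    ... | zero = contradiction (sym (separate eq)) (off ≤-refl)
    ... | suc s = ∸-monoʳ-< (s≤s z≤n) (subst (_≤ D) eq (bounded (u D) z))

    u0∈R-beyond : 1 ≤ D → u 0 ∈ₗ R.beyond
    u0∈R-beyond 1≤D = subst (λ c → u c ∈ₗ R.beyond) (trans (cong (D ∸_) (m+[n∸m]≡n 1≤D)) (n∸n≡0 D))
      (∈-applyUpTo⁺ (λ a → u (D ∸ suc a)) (∸-monoʳ-< (s≤s z≤n) 1≤D))

    -- Distances from z to the path, except to its vertices u a with level z ≤ a ≤ colevel z,
    -- of which there is at most one.
    record Flanked (z : Fin n) : Set where
      field
        below : ∀ {a} → a < level z → d z (u a) + a ≡ level z
        above : ∀ {a} → colevel z < a → a ≤ D → d z (u a) + colevel z ≡ a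
    open Flanked

    -- Alignment is asked only of neighbours one step closer to an end, so that this applies while
    -- one vertex is not yet known to be aligned for the reversed path.
    flanked : ∀ {z} → Off z →
      (∀ v → Off v → d z v ≡ 1 → suc (level v) ≡ level z → Aligned v) →
      (∀ v → Off v → d z v ≡ 1 → suc (R.level v) ≡ R.level z → R.Aligned v) → Flanked z
    flanked {z} off al alᴿ = record { below = near z off al ; above = far }
      where
      far : ∀ {a} → colevel z < a → a ≤ D → d z (u a) + colevel z ≡ a
      far {a} e<a a≤D = +-cancelʳ-≡ (D ∸ a) _ _ (begin
        d z (u a) + colevel z + (D ∸ a)     ≡⟨ +-assoc (d z (u a)) _ _ ⟩
        d z (u a) + (colevel z + (D ∸ a))   ≡⟨ cong (d z (u a) +_) (+-comm (colevel z) _) ⟩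
        d z (u a) + ((D ∸ a) + colevel z)   ≡⟨ +-assoc (d z (u a)) _ _ ⟨
        d z (u a) + (D ∸ a) + colevel z     ≡⟨ cong (λ c → d z (u c) + (D ∸ a) + colevel z) (m∸[m∸n]≡n a≤D) ⟨
        d z (u (D ∸ (D ∸ a))) + (D ∸ a) + colevel z
          ≡⟨ cong (_+ colevel z) (R.near z (off-reverse off) (λ v → alᴿ v ∘ off-unreverse) D∸a<s) ⟩
        R.level z + (D ∸ R.level z)         ≡⟨ m+[n∸m]≡n s≤D ⟩
        D                                   ≡⟨ m+[n∸m]≡n a≤D ⟨
        a + (D ∸ a)                         ∎)
        where
        open ≡-Reasoning
        s≤D : R.level z ≤ D
        s≤D = bounded (u D) z
        D∸a<s : D ∸ a < R.level z
        D∸a<s = subst (D ∸ a <_) (m∸[m∸n]≡n s≤D) (∸-monoʳ-< e<a a≤D)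

    -- When the levels coincide, the two flanks cover the whole path except the foot itself;
    -- alignment handles the vertices off the path.
    foot-twins : ∀ {z} → Aligned z → Flanked z → level z ≡ colevel z → Twins z (foot z)
    foot-twins {z} al fl i≡e w w≢z w≢foot with on⊎off w
    ... | inj₂ off-w = al w off-w w≢z
    ... | inj₁ (a , a≤D , refl) with <-cmp a (level z)
    ...   | tri< a<i _ _ = +-cancelʳ-≡ a _ _ (trans (below fl a<i)
            (trans (sym (gap (<⇒≤ a<i) (bounded (u 0) z))) (cong (_+ a) (symmetric (u a) _))))
    ...   | tri≈ _ refl _ = contradiction refl w≢foot
    ...   | tri> _ _ i<a = +-cancelʳ-≡ (level z) _ _ (trans (cong (d z (u a) +_) i≡e)
            (trans (above fl (subst (_< a) i≡e i<a) a≤D) (sym (gap (<⇒≤ i<a) a≤D))))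

    -- Along the path the distance from `z` strictly decreases before `level z` and strictly
    -- increases after `colevel z`, so equal values cannot occur twice on one flank.
    straddle : ∀ {z a b} → Flanked z → a < b → b ≤ D → d z (u a) ≡ d z (u b) → level z ≤ b × a ≤ colevel z
    straddle {z} {a} {b} fl a<b b≤D same = ≮⇒≥ b≮i , ≮⇒≥ e≮a
      where
      b≮i : ¬ b < level z
      b≮i b<i = <⇒≢ a<b (+-cancelˡ-≡ (d z (u b)) _ _ (trans (cong (_+ a) (sym same))
        (trans (below fl (<-trans a<b b<i)) (sym (below fl b<i)))))
      e≮a : ¬ colevel z < a
      e≮a e<a = <⇒≢ a<b (trans (sym (above fl e<a (≤-trans (<⇒≤ a<b) b≤D)))
        (trans (cong (_+ colevel z) same) (above fl (<-trans e<a a<b) b≤D)))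

    -- With `colevel y < level y` the flanks cover the entire path, so the two numbers determine all
    -- distances to it; off the path both vertices are compared with their common foot.
    same-sides-twins : ∀ {y z} → Aligned y → Aligned z → Flanked y → Flanked z → colevel y < level y →
      level y ≡ level z → colevel y ≡ colevel z → Twins y z
    same-sides-twins {y} {z} al-y al-z fl-y fl-z e<i i≡ e≡ w w≢y w≢z with on⊎off w
    ... | inj₂ off-w = trans (al-y w off-w w≢y) (trans (cong (λ i → d (u i) w) i≡) (sym (al-z w off-w w≢z)))
    ... | inj₁ (a , a≤D , refl) with a <? level y
    ...   | yes a<i = +-cancelʳ-≡ a _ _ (trans (below fl-y a<i)
            (trans i≡ (sym (below fl-z (subst (a <_) i≡ a<i)))))
    ...   | no a≮i = +-cancelʳ-≡ (colevel y) _ _ (trans (above fl-y e<a a≤D)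
            (trans (sym (above fl-z (subst (_< a) e≡ e<a) a≤D)) (cong (d z (u a) +_) (sym e≡))))
      where
      e<a : colevel y < a
      e<a = <-≤-trans e<i (≮⇒≥ a≮i)

  -- Contradiction from a unique basis of `n − D − 1` elements

  module Extremal {D} (bounded : ∀ x y → d x y ≤ D) {W : Subset n} (resolves : Resolving d W)
    (largest : ∀ W′ → Resolving d W′ → ∣ W′ ∣ + suc D ≤ n → W′ ≡ W) (size : ∣ W ∣ + suc D ≤ n)
    (twin∈ : ∀ {p q} → p ≢ q → Twins p q → p ∈ W) where

    module OneSided (γ : Geodesic d D) (aligned : Path.AllAligned bounded γ) where
      open TwoSided bounded γ
      open Flanked

      foot∈ : ∀ {z} → Off z → Flanked z → level z ≡ colevel z → foot z ∈ W
      foot∈ {z} off fl i≡e = twin∈ (off (bounded (u 0) z) ∘ sym) (twins-sym (foot-twins (aligned z off) fl i≡e))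

      -- Alignment from one end forces alignment from the other

      module Exception (z : Fin n) (off : Off z) (W≡ : without (z ∷ R.beyond) ≡ W) where

        -- There is at most one exception: with a second one, `v`, the set `W` would both contain
        -- and omit `v`.
        alignedᴿ-others : ∀ v → Off v → v ≢ z → R.Aligned v
        alignedᴿ-others v off-v v≢z with R.aligned⊎resolving v (off-reverse off-v)
        ... | inj₁ al = al
        ... | inj₂ res = contradiction
          (subst (v ∈_) (trans W≡ (sym (largest _ res (R.∣without-z∷beyond∣ (off-reverse off-v))))) (∈-without _ v∉))
          (∉-without (v ∷ R.beyond) (here refl))
          where
          v∉ : v ∉ₗ z ∷ R.beyond
          v∉ (here v≡z) = v≢z v≡z
          v∉ (there v∈) = R.off⇒∉beyond (off-reverse off-v) v∈

        u∉W : ∀ {a} → a < D → u a ∉ W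
        u∉W {a} a<D ua∈W = ∉-without (z ∷ R.beyond) (there ua∈) (subst (u a ∈_) (sym W≡) ua∈W)
          where
          ua∈ : u a ∈ₗ R.beyond
          ua∈ = subst (λ c → u c ∈ₗ R.beyond) (trans (cong (D ∸_) (sym (+-∸-assoc 1 a<D))) (m∸[m∸n]≡n (<⇒≤ a<D)))
            (∈-applyUpTo⁺ (λ k → u (D ∸ suc k)) (∸-monoʳ-< {D} (s≤s z≤n) a<D))

        apart : ∀ {v} → d z v ≡ 1 → v ≢ z
        apart dzv refl = 0≢1+n (trans (sym (reflexive z)) dzv)

        alignedᴿ-level : level z ≡ colevel z → R.Aligned z
        alignedᴿ-level i≡e w off-w w≢z = trans (aligned z off w (off-unreverse off-w) w≢z) (cong (λ i → d (u i) w) i≡e)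

        module Gap (e<i : colevel z < level z) where

          flanked-z : Flanked z
          flanked-z = flanked off (λ v off-v _ _ → aligned v off-v)
            λ v off-v dzv _ → alignedᴿ-others v off-v (apart dzv)

          flanked-others : ∀ {w} → Off w → w ≢ z → Flanked w
          flanked-others {w} off-w w≢z = flanked off-w (λ v off-v _ _ → aligned v off-v)
            λ v off-v dwv lv → alignedᴿ-others v off-v λ { refl → not-next dwv lv }
            where
            -- If `z` came next after `w` towards `u D`, then `u (colevel w)` would be adjacent to
            -- `z`, giving `level z ≤ colevel w + 1 = colevel z`.
            not-next : d w z ≡ 1 → suc (R.level z) ≢ R.level w
            not-next dwz s≡ = <⇒≱ e<i (begin
              level z                               ≤⟨ triangle (u 0) (u (colevel w)) z ⟩
              level (u (colevel w)) + d (u (colevel w)) z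
                ≡⟨ cong₂ _+_ (level-u (m∸n≤m D (R.level w))) (sym (alignedᴿ-others w off-w w≢z z (off-reverse off) (w≢z ∘ sym))) ⟩
              colevel w + d w z                     ≡⟨ cong (colevel w +_) dwz ⟩
              colevel w + 1                         ≡⟨ +-comm (colevel w) 1 ⟩
              suc (D ∸ R.level w)                   ≡⟨ cong (λ s → suc (D ∸ s)) s≡ ⟨
              suc (D ∸ suc (R.level z))             ≡⟨ +-∸-assoc 1 (subst (_≤ D) (sym s≡) (bounded (u D) w)) ⟨
              D ∸ R.level z                         ∎)
              where open ≤-Reasoning

          -- Both feet of `w` are as far from `z` as `w` is, hence they straddle `z`. Comparing
          -- distances gives `w` the level and colevel of `z`, and then both sides equal
          -- `level z − colevel z`.
          alignedᴿ-gap : R.Aligned z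
          alignedᴿ-gap w off-wᴿ w≢z = +-cancelʳ-≡ (colevel w) _ _ (trans above-e (sym (trans
              (cong (λ e → d (u e) w + colevel w) (sym e≡)) (trans (cong (_+ colevel w) (symmetric _ w))
              (trans (below fl-w ew<iw) (sym iz≡iw))))))
            where
            off-w = off-unreverse off-wᴿ
            fl-w = flanked-others off-w w≢z

            ew<iw : colevel w < level w
            -- Equality would put `foot w` into `W` as a twin of `w`, but `W` omits every path
            -- vertex before `u D`.
            ew<iw = ≤∧≢⇒< (colevel≤level w) λ e≡i →
              u∉W (subst (_< D) e≡i (colevel<D off-w)) (foot∈ off-w fl-w (sym e≡i))

            to-foot : d z (u (level w)) ≡ d z w
            to-foot = trans (symmetric z _) (trans (sym (aligned w off-w z off (w≢z ∘ sym))) (symmetric w z))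

            to-cofoot : d z (u (colevel w)) ≡ d z w
            to-cofoot = trans (symmetric z _)
              (trans (sym (alignedᴿ-others w off-w w≢z z (off-reverse off) (w≢z ∘ sym))) (symmetric w z))

            straddled : level z ≤ level w × colevel w ≤ colevel z
            straddled = straddle flanked-z ew<iw (bounded (u 0) w) (trans to-cofoot (sym to-foot))

            above-i : d z w + colevel z ≡ level w
            above-i = trans (cong (_+ colevel z) (sym to-foot))
              (above flanked-z (<-≤-trans e<i (proj₁ straddled)) (bounded (u 0) w))

            above-e : d z w + colevel w ≡ level z
            above-e = trans (cong (_+ colevel w) (sym to-cofoot)) (below flanked-z (≤-<-trans (proj₂ straddled) e<i))

            iz≡iw : level z ≡ level w
            -- If `level z < level w`, alignment of `z` gives `d z w + level z = level w`, and
            -- `above-i` then yields `level z = colevel z`.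
            iz≡iw = ≤∧≮⇒≡ (proj₁ straddled) λ iz<iw → <⇒≢ e<i (+-cancelˡ-≡ (d z w) _ _ (trans above-i
              (trans (sym (below fl-w iz<iw)) (cong (_+ level z)
                (trans (symmetric w _) (sym (aligned z off w off-w w≢z)))))))

            e≡ : colevel w ≡ colevel z
            e≡ = +-cancelˡ-≡ (d z w) _ _ (trans above-e (trans iz≡iw (sym above-i)))

        alignedᴿ-exception : R.Aligned z
        alignedᴿ-exception with level z ≟ colevel z
        ... | yes i≡e = alignedᴿ-level i≡e
        ... | no i≢e = Gap.alignedᴿ-gap (≤∧≢⇒< (colevel≤level z) (i≢e ∘ sym))

      alignedᴿ : ∀ z → Off z → R.Aligned z
      alignedᴿ z off with R.aligned⊎resolving z (off-reverse off)
      ... | inj₁ al = al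
      ... | inj₂ res = Exception.alignedᴿ-exception z off (largest _ res (R.∣without-z∷beyond∣ (off-reverse off)))

      -- Twin pairs once both directions are aligned

      flanked-all : ∀ {z} → Off z → Flanked z
      flanked-all off = flanked off (λ v off-v _ _ → aligned v off-v) (λ v off-v _ _ → alignedᴿ v off-v)

      z∈W⊎sided : ∀ {z} → Off z → (z ∈ W × foot z ∈ W × level z ≡ colevel z) ⊎ colevel z < level z
      z∈W⊎sided {z} off with level z ≟ colevel z
      ... | yes i≡e = inj₁ ( twin∈ (off (bounded (u 0) z)) (foot-twins (aligned z off) (flanked-all off) i≡e)
                           , foot∈ off (flanked-all off) i≡e , i≡e)
      ... | no i≢e = inj₂ (≤∧≢⇒< (colevel≤level z) (i≢e ∘ sym))

      -- By the two alignments `y` is equidistant from both feet of `z`, so these straddle `y`;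
      -- exchanging the roles makes levels and colevels equal.
      sided-twins : ∀ {y z} → Off y → Off z → y ≢ z → colevel y < level y → colevel z < level z → Twins y z
      sided-twins {y} {z} off-y off-z y≢z ey<iy ez<iz =
        same-sides-twins (aligned y off-y) (aligned z off-z) (flanked-all off-y) (flanked-all off-z) ey<iy
          (≤-antisym (proj₁ y-in-z) (proj₁ z-in-y)) (≤-antisym (proj₂ z-in-y) (proj₂ y-in-z))
        where
        narrow : ∀ {y z} → Off y → Off z → y ≢ z → colevel z < level z → level y ≤ level z × colevel z ≤ colevel y
        narrow {y} {z} off-y off-z y≢z ez<iz = straddle (flanked-all off-y) ez<iz (bounded (u 0) z)
          (trans (symmetric y _) (trans (sym (alignedᴿ z off-z y (off-reverse off-y) y≢z))
            (trans (aligned z off-z y off-y y≢z) (symmetric _ y))))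
        y-in-z = narrow off-y off-z y≢z ez<iz
        z-in-y = narrow off-z off-y (y≢z ∘ sym) ey<iy

      -- Counting the vertices outside `W`

      path : List (Fin n)
      path = applyUpTo u (suc D)

      ∈-path : ∀ {x} → ¬ Off x → x ∈ₗ path
      ∈-path {x} on with on⊎off x
      ... | inj₁ (a , a≤D , refl) = ∈-applyUpTo⁺ u (s≤s a≤D)
      ... | inj₂ off = ⊥-elim (on off)

      -- The path has `D + 1` vertices, so those off it already number at least `n − D − 1`, and
      -- `size` leaves room for no more.
      off-contained⇒path∩W≡∅ : (∀ z → Off z → z ∈ W) → ∀ {a} → a ≤ D → u a ∉ W
      off-contained⇒path∩W≡∅ off⊆W {a} a≤D ua∈W = <-irrefl refl (begin-strict
        ∣ W - u a ∣ + suc D           <⟨ +-monoˡ-< (suc D) (x∈p⇒∣p-x∣<∣p∣ ua∈W) ⟩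
        ∣ W ∣ + suc D                 ≤⟨ size ⟩
        n                             ≤⟨ covered (W - u a) path cov ⟩
        ∣ W - u a ∣ + length path     ≡⟨ cong (∣ W - u a ∣ +_) (length-applyUpTo u (suc D)) ⟩
        ∣ W - u a ∣ + suc D           ∎)
        where
        open ≤-Reasoning
        cov : ∀ x → x ∉ W - u a → x ∈ₗ path
        cov x x∉ = ∈-path λ off → x∉ (x∈p∧x≢y⇒x∈p-y (off⊆W x off) (off a≤D))

      -- The same count with `z` added to the path: two path vertices in `W` would be one too many.
      off-contained-but-one⇒path∩W-singleton : ∀ z → (∀ v → Off v → v ≢ z → v ∈ W) →
        ∀ {a b} → a ≤ D → b ≤ D → u a ∈ W → u b ∈ W → a ≡ b
      off-contained-but-one⇒path∩W-singleton z off⊆W {a} {b} a≤D b≤D ua∈W ub∈W = decidable-stable (a ≟ b) λ a≢b →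
        <-irrefl refl (begin-strict
          ∣ W - u a - u b ∣ + suc (suc D)         ≡⟨ +-suc _ (suc D) ⟩
          suc ∣ W - u a - u b ∣ + suc D           ≤⟨ +-monoˡ-≤ (suc D) (x∈p⇒∣p-x∣<∣p∣ (ub∈ a≢b)) ⟩
          ∣ W - u a ∣ + suc D                     <⟨ +-monoˡ-< (suc D) (x∈p⇒∣p-x∣<∣p∣ ua∈W) ⟩
          ∣ W ∣ + suc D                           ≤⟨ size ⟩
          n                                       ≤⟨ covered (W - u a - u b) (z ∷ path) cov ⟩
          ∣ W - u a - u b ∣ + length (z ∷ path)   ≡⟨ cong (λ l → ∣ W - u a - u b ∣ + suc l) (length-applyUpTo u (suc D)) ⟩
          ∣ W - u a - u b ∣ + suc (suc D)         ∎)
        where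
        open ≤-Reasoning
        ub∈ : a ≢ b → u b ∈ W - u a
        ub∈ a≢b = x∈p∧x≢y⇒x∈p-y ub∈W (a≢b ∘ sym ∘ u-injective b≤D a≤D)
        cov : ∀ x → x ∉ W - u a - u b → x ∈ₗ z ∷ path
        cov x x∉ with x ≟ꟳ z
        ... | yes x≡z = here x≡z
        ... | no x≢z = there (∈-path λ off →
          x∉ (x∈p∧x≢y⇒x∈p-y (x∈p∧x≢y⇒x∈p-y (off⊆W x off x≢z) (off a≤D)) (off b≤D)))

      cofoot≢foot : ∀ {z} → colevel z < level z → u (level z) ≢ u (colevel z)
      cofoot≢foot {z} e<i e = <⇒≢ e<i (sym (u-injective (bounded (u 0) z) (m∸n≤m D (R.level z)) e))

      -- Excluding the two possible shapes of `W`

      module OffOutside (z : Fin n) (off : Off z) (z∉W : z ∉ W) (some : ∃[ w ] w ∈ W) where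

        e<i : colevel z < level z
        e<i with z∈W⊎sided off
        ... | inj₁ (z∈W , _) = contradiction z∈W z∉W
        ... | inj₂ e<i = e<i

        -- A second vertex with `colevel v < level v` would be a twin of `z` and so put `z` into
        -- `W`.
        others : ∀ {v} → Off v → v ≢ z → v ∈ W × foot v ∈ W × level v ≡ colevel v
        others off-v v≢z with z∈W⊎sided off-v
        ... | inj₁ in-W = in-W
        ... | inj₂ ev<iv = contradiction (twin∈ (v≢z ∘ sym) (sided-twins off off-v (v≢z ∘ sym) e<i ev<iv)) z∉W

        ∈W⇒≢z : ∀ {v} → v ∈ W → v ≢ z
        ∈W⇒≢z v∈W refl = z∉W v∈W

        on-path : ∃[ w ] w ∈ W → ∃[ a ] a ≤ D × u a ∈ W
        on-path (w , w∈W) with on⊎off w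
        ... | inj₁ (a , a≤D , refl) = a , a≤D , w∈W
        ... | inj₂ off-w = level w , bounded (u 0) w , proj₁ (proj₂ (others off-w (∈W⇒≢z w∈W)))

        anchor = on-path some
        α = proj₁ anchor
        α≤D = proj₁ (proj₂ anchor)
        uα∈W = proj₂ (proj₂ anchor)

        only : ∀ {b} → b ≤ D → u b ∈ W → b ≡ α
        only b≤D ub∈W = off-contained-but-one⇒path∩W-singleton z (λ v off-v v≢z → proj₁ (others off-v v≢z))
          b≤D α≤D ub∈W uα∈W

        -- W consists of u α and twins of it, so u α alone separates what W separates outside W.
        anchor-separates : ∀ {p q} → p ∉ W → q ∉ W → d (u α) p ≡ d (u α) q → p ≡ q
        anchor-separates {p} {q} p∉W q∉W same = resolves p q λ w w∈W → sep w w∈W (on⊎off w)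
          where
          sep : ∀ w → w ∈ W → (∃[ a ] a ≤ D × w ≡ u a) ⊎ Off w → d p w ≡ d q w
          sep w w∈W (inj₁ (a , a≤D , refl)) with refl ← only a≤D w∈W =
            trans (symmetric p _) (trans same (symmetric _ q))
          sep w w∈W (inj₂ off-w) = trans (symmetric p w) (trans (as-anchor p∉W)
            (trans same (trans (sym (as-anchor q∉W)) (symmetric w q))))
            where
            w-other = others off-w (∈W⇒≢z w∈W)
            as-anchor : ∀ {x} → x ∉ W → d w x ≡ d (u α) x
            as-anchor {x} x∉W = subst (λ a → d w x ≡ d (u a) x) (only (bounded (u 0) w) (proj₁ (proj₂ w-other)))
              (foot-twins (aligned w off-w) (flanked-all off-w) (proj₂ (proj₂ w-other)) x
                (λ { refl → x∉W w∈W }) (λ { refl → x∉W (proj₁ (proj₂ w-other)) }))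

        outside-W : ∀ {b} → b ≤ D → b ≢ α → u b ∉ W
        outside-W b≤D b≢α ub∈W = b≢α (only b≤D ub∈W)

        -- Two vertices outside `W` are equidistant from `u α`: `z` and its foot if `α` is 0, `z`
        -- and `u (colevel z)` if `α` is `D`, and the two path neighbours of `u α` otherwise.
        impossible : ⊥
        impossible with α ≟ 0 | α ≟ D
        ... | yes α≡0 | _ = off (bounded (u 0) z) (sym (anchor-separates
              (outside-W (bounded (u 0) z) λ i≡α → n≮0 (subst (colevel z <_) (trans i≡α α≡0) e<i)) z∉W
              (subst (λ a → d (u a) (foot z) ≡ d (u a) z) (sym α≡0) (level-u (bounded (u 0) z)))))
        ... | no _ | yes α≡D = off (m∸n≤m D (R.level z)) (sym (anchor-separates
              (outside-W (m∸n≤m D (R.level z)) λ e≡α → <⇒≢ (colevel<D off) (trans e≡α α≡D)) z∉W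
              (subst (λ a → d (u a) (u (colevel z)) ≡ d (u a) z) (sym α≡D) (R.level-u (bounded (u D) z)))))
        ... | no α≢0 | no α≢D = neighbours α refl
          where
          neighbours : ∀ a → a ≡ α → ⊥
          neighbours zero 0≡α = α≢0 (sym 0≡α)
          neighbours (suc a) 1+a≡α = <⇒≢ (m≤n⇒m≤1+n ≤-refl) (u-injective a≤D 2+a≤D (anchor-separates
            (outside-W a≤D λ a≡α → 1+n≢n (trans 1+a≡α (sym a≡α)))
            (outside-W 2+a≤D λ 2+a≡α → 1+n≢n (trans 2+a≡α (sym 1+a≡α)))
            (subst (λ c → d (u c) (u a) ≡ d (u c) (u (2 + a))) 1+a≡α (trans (symmetric _ _) (trans
              (+-cancelʳ-≡ a _ 1 (gap (n≤1+n a) (<⇒≤ 2+a≤D)))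
              (sym (+-cancelʳ-≡ (suc a) _ 1 (gap (n≤1+n (suc a)) 2+a≤D))))))))
            where
            2+a≤D : 2 + a ≤ D
            2+a≤D = subst (_< D) (sym 1+a≡α) (≤∧≢⇒< α≤D α≢D)
            a≤D : a ≤ D
            a≤D = <⇒≤ (<⇒≤ 2+a≤D)

      -- Here `W` is disjoint from the path. If `w` in `W` has `colevel w < level w`, its two feet
      -- are not separated: any other element of `W` is as far from either as from `w`, and `w` is
      -- equidistant from both.
      no-off-outside : (∀ z → Off z → z ∈ W) → ¬ (∃[ w ] w ∈ W)
      no-off-outside off⊆W (w , w∈W) with on⊎off w
      ... | inj₁ (a , a≤D , refl) = off-contained⇒path∩W≡∅ off⊆W a≤D w∈W
      ... | inj₂ off with z∈W⊎sided off
      ...   | inj₁ (_ , foot∈W , _) = off-contained⇒path∩W≡∅ off⊆W (bounded (u 0) w) foot∈W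
      ...   | inj₂ e<i = cofoot≢foot e<i (resolves _ _ same)
        where
        same : ∀ v → v ∈ W → d (u (level w)) v ≡ d (u (colevel w)) v
        same v v∈W with on⊎off v | v ≟ꟳ w
        ... | inj₁ (a , a≤D , refl) | _ = contradiction v∈W (off-contained⇒path∩W≡∅ off⊆W a≤D)
        ... | inj₂ off-v | no v≢w = trans (sym (aligned w off v off-v v≢w)) (alignedᴿ w off v (off-reverse off-v) v≢w)
        ... | inj₂ _ | yes refl = trans (symmetric _ w) (trans
              (+-cancelʳ-≡ (colevel w) _ _ (trans (above (flanked-all off) e<i (bounded (u 0) w))
                (sym (below (flanked-all off) e<i))))
              (symmetric w _))

      impossible : ∃[ w ] w ∈ W → ⊥
      impossible some with any? (λ z → off? z ×-dec ¬? (z ∈? W))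
      ... | yes (z , off , z∉W) = OffOutside.impossible z off z∉W some
      ... | no none = no-off-outside (λ z off → decidable-stable (z ∈? W) λ z∉W → none (z , off , z∉W)) some

    -- An unaligned `z` would make `W` the complement of `z ∷ beyond`, which contains `u 0`.
    aligned⊎endpoint : ∀ γ → Path.AllAligned bounded γ ⊎ Geodesic.u γ 0 ∈ W
    aligned⊎endpoint γ with Geodesic.u γ 0 ∈? W
    ... | yes u0∈W = inj₂ u0∈W
    ... | no u0∉W = inj₁ al
      where
      open Path bounded γ
      al : AllAligned
      al z off with aligned⊎resolving z off
      ... | inj₁ al-z = al-z
      ... | inj₂ res = contradiction
        (subst (u 0 ∈_) (largest _ res (∣without-z∷beyond∣ off)) (∈-without _ (u0∉z∷beyond off))) u0∉W

    -- If u 0 ∈ W, then no set omitting u 0 is W, which makes the reversed geodesic aligned.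
    contradictory : Geodesic d D → 1 ≤ D → ∃[ w ] w ∈ W → ⊥
    contradictory γ 1≤D some with aligned⊎endpoint γ
    ... | inj₁ al = OneSided.impossible γ al some
    ... | inj₂ u0∈W = OneSided.impossible (reverse γ) al some
      where
      open TwoSided bounded γ
      al : R.AllAligned
      al z off with R.aligned⊎resolving z off
      ... | inj₁ al-z = al-z
      ... | inj₂ res = contradiction
        (subst (u 0 ∈_) (sym (largest _ res (R.∣without-z∷beyond∣ off))) u0∈W)
        (∉-without (z ∷ R.beyond) (there (u0∈R-beyond 1≤D)))

-- Reduction of the bound to the extremal case

theorem1 : (n : ℕ) → 2 ≤ n → (G : Graph n) → Connected G →
    (d : Fin n → Fin n → ℕ) → IsDistance G d →
    (D : ℕ) → IsDiameter d D → UniquelyDimensional d →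
    ∀ W → MetricBasis d W → ∣ W ∣ + D + 2 ≤ n
theorem1 n@(suc (suc m)) (s≤s (s≤s z≤n)) G _ d isd D (bounded , x , y , dxy≡D) (_ , unique) W basis@(res , least) =
  -- Failure of the bound means `∣ W ∣ ≥ n − D − 1`; `size` supplies the reverse inequality.
  ≮⇒≥ λ n< → Extremal.contradictory bounded res (largest n<) size twin∈ γ 1≤D nonempty
  where
  open PathMetric (distance⇒metric isd)

  0≢1 : Fin.zero {suc m} ≢ Fin.suc Fin.zero
  0≢1 ()

  γ : Geodesic d D
  γ = geodesic dxy≡D

  module P = TwoSided bounded γ

  smallest⇒≡W : ∀ W′ → Resolving d W′ → ∣ W′ ∣ ≤ ∣ W ∣ → W′ ≡ W
  smallest⇒≡W W′ res′ le = unique W′ W (res′ , λ V resV → ≤-trans le (least V resV)) basis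

  1≤D : 1 ≤ D
  1≤D = ≤-trans (n≢0⇒n>0 (0≢1 ∘ separate)) (bounded Fin.zero (Fin.suc Fin.zero))

  nonempty : ∃[ w ] w ∈ W
  nonempty with any? (_∈? W)
  ... | yes some = some
  ... | no none = contradiction (res Fin.zero (Fin.suc Fin.zero) λ w w∈W → contradiction (w , w∈W) none) 0≢1

  -- If `W` missed both twins it would not separate them; if it contained only `q`, the exchange
  -- would give another basis, which uniqueness excludes.
  twin∈ : ∀ {p q} → p ≢ q → Twins p q → p ∈ W
  twin∈ {p} {q} p≢q tw with p ∈? W | q ∈? W
  ... | yes p∈W | _ = p∈W
  ... | no p∉W | no q∉W = contradiction
    (res p q λ w w∈W → tw w (λ { refl → p∉W w∈W }) (λ { refl → q∉W w∈W })) p≢q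
  ... | no p∉W | yes q∈W = subst (p ∈_)
    (smallest⇒≡W _ (resolving-swap tw p∉W q∈W res)
      (≤-trans (∣p∪⁅x⁆∣≤1+∣p∣ (W - q) p) (x∈p⇒∣p-x∣<∣p∣ q∈W)))
    (x∈p∪q⁺ (inj₂ (x∈⁅x⁆ p)))

  -- Otherwise the path without u 0 and the path without u D would both be the complement of W.
  size : ∣ W ∣ + suc D ≤ n
  size = ≮⇒≥ λ n< → ends (≤-pred (subst (n <_) (+-suc ∣ W ∣ D) n<))
    where
    ends : ¬ n ≤ ∣ W ∣ + D
    ends n≤ = ∉-without P.R.beyond (P.u0∈R-beyond 1≤D) (subst (P.u 0 ∈_)
      (trans (is-W P.resolving-beyond P.∣without-beyond∣) (sym (is-W P.R.resolving-beyond P.R.∣without-beyond∣)))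
      (∈-without P.beyond P.u0∉beyond))
      where
      is-W : ∀ {W′} → Resolving d W′ → ∣ W′ ∣ + D ≤ n → W′ ≡ W
      is-W res′ le = smallest⇒≡W _ res′ (+-cancelʳ-≤ D _ _ (≤-trans le n≤))

  largest : n < ∣ W ∣ + D + 2 → ∀ W′ → Resolving d W′ → ∣ W′ ∣ + suc D ≤ n → W′ ≡ W
  largest n< W′ res′ le = smallest⇒≡W W′ res′ (+-cancelʳ-≤ (suc D) _ _ (≤-trans le (≤-pred (begin
    suc n                   ≤⟨ n< ⟩
    ∣ W ∣ + D + 2           ≡⟨ +-assoc ∣ W ∣ D 2 ⟩
    ∣ W ∣ + (D + 2)         ≡⟨ cong (∣ W ∣ +_) (+-comm D 2) ⟩
    ∣ W ∣ + suc (suc D)     ≡⟨ +-suc ∣ W ∣ (suc D) ⟩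
    suc (∣ W ∣ + suc D)     ∎))))
    where open ≤-Reasoning
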